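{- Let $p$ be a prime, $n=ap^h$ with $h\ge 0$ and $1\le a\le p-1$, and let $k$ be an integer with $1\le k\le n$ and $(p-1)\mid (n-k)$. Then $S(n,k)$ is a minimum zero case, and \[ \nu_p(S(n,k)) = \frac{\sigma_p(k)-\sigma_p(n)}{p-1} = \frac{\sigma_p(k)-a}{p-1}. \]
   Context: $S(n,k)$ is the Stirling number of the second kind, $\nu_p$ the $p$-adic valuation, and $\sigma_p(m)$ the base-$p$ digit sum of $m$. $S(n,k)$ is called a minimum zero case if $\nu_p(S(n,k)) = (\sigma_p(k)-\sigma_p(n))/(p-1)$. -}

module Defs where

open import Data.Nat using (ℕ; zero; suc; _+_; _*_; _∸_; _^_; NonZero)
open import Data.Nat.DivMod using (_/_; _%_)
open import Data.Nat.Divisibility using (_∣_)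
open import Relation.Nullary using (¬_)
open import Data.Product using (_×_)

S : ℕ → ℕ → ℕ
S zero    zero    = 1
S zero    (suc k) = 0
S (suc n) zero    = 0
S (suc n) (suc k) = suc k * S n (suc k) + S n k

-- base-p digit sum, computed with fuel (fuel ≥ m suffices since m/p < m for p ≥ 2)
digitSumFuel : ℕ → (p : ℕ) → .{{NonZero p}} → ℕ → ℕ
digitSumFuel zero       p m = 0
digitSumFuel (suc fuel) p zero = 0
digitSumFuel (suc fuel) p m@(suc _) = m % p + digitSumFuel fuel p (m / p)

σ : (p : ℕ) → .{{NonZero p}} → ℕ → ℕ
σ p m = digitSumFuel m p m

IsValuation : ℕ → ℕ → ℕ → Set
IsValuation p m v = (p ^ v ∣ m) × ¬ (p ^ suc v ∣ m)

{-# OPTIONS --safe #-}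
module Submission where

-- Put T(n,k) = k! S(n,k), the k-th finite difference of yⁿ at 0.  Expanding Δᵏ E^p yⁿ at 0
-- both as Δᵏ (1 + Δ)^p yⁿ and as Δᵏ (y + p)ⁿ shows that, modulo terms of higher p-adic order,
--   T(n,k+p) + p T(n,k+1) = p n T(n-1,k).
-- For n = k + (p - 1) e this becomes Pascal's rule for (-p)^e T(n,k) / n! modulo p, so that
-- this p-integral number is congruent to C(k + p e, e).  If n = a p^h then k + p e = n + e
-- and e < p^h, hence the binomial coefficient is prime to p, and p^e k! S(n,k) has the same
-- valuation as n!.  Legendre's formula for k! and n! gives the claim.

open import Defs
open import Data.Nat using (ℕ; zero; suc; _+_; _*_; _∸_; _^_; _≤_; _<_; z≤n; s≤s; NonZero; _!)
open import Data.Nat.Properties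
open import Data.Nat.Combinatorics using (_C_; nCk+nC[k+1]≡[n+1]C[k+1]; k>n⇒nCk≡0;
  nCk≡n!/k![n-k]!; k![n∸k]!∣n!; nCn≡1; nC1≡n)
open import Data.Nat.Divisibility using (_∣_; divides; ∣-trans; ∣1⇒≡1; m∣m*n; n∣m*n; _∣?_)
import Data.Nat.Divisibility as ℕ∣
open import Data.Nat.DivMod
open import Data.Nat.Induction using (<-rec)
open import Data.Nat.Primality using (Prime; euclidsLemma; prime⇒nonZero; ¬prime[0]; ¬prime[1])
open import Data.Integer using (ℤ; +_; 0ℤ; 1ℤ)
import Data.Integer as ℤ
import Data.Integer.Properties as ℤ
import Data.Nat.Tactic.RingSolver as ℕ-Solver
import Data.Integer.Tactic.RingSolver as ℤ-Solver
import Algebra.Properties.AbelianGroup ℤ.+-0-abelianGroup as ℤ+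
open import Data.Product using (_×_; _,_; proj₁; proj₂; ∃-syntax)
open import Data.Sum using (inj₁; inj₂; [_,_]′)
open import Function using (_∘_)
open import Relation.Binary.PropositionalEquality
open import Relation.Nullary using (¬_; yes; no; contradiction)
open ≡-Reasoning

-- The numbers k! S(n,k) and sums with binomial weights.

T : ℕ → ℕ → ℤ
T n k = + (k ! * S n k)

T-suc : ∀ n k → T (suc n) (suc k) ≡ + suc k ℤ.* (T n (suc k) ℤ.+ T n k)
T-suc n k = trans (cong +_ (rearrange (suc k) (k !) (S n (suc k)) (S n k)))
                  (ℤ.pos-* (suc k) _)
  where
  rearrange : ∀ c f x y → (c * f) * (c * x + y) ≡ c * ((c * f) * x + f * y)
  rearrange = ℕ-Solver.solve-∀

T-zero-suc : ∀ k → T 0 (suc k) ≡ 0ℤ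
T-zero-suc k = cong +_ (*-zeroʳ (suc k !))

-- Outside this block a sum is an atom, rewritten only by the lemmas proved here.
opaque
  ∑ : ℕ → (ℕ → ℤ) → ℤ
  ∑ zero    f = 0ℤ
  ∑ (suc n) f = f 0 ℤ.+ ∑ n (f ∘ suc)

  ∑-zero : ∀ f → ∑ 0 f ≡ 0ℤ
  ∑-zero f = refl

  ∑-first : ∀ n f → ∑ (suc n) f ≡ f 0 ℤ.+ ∑ n (f ∘ suc)
  ∑-first n f = refl

  ∑-cong : ∀ n {f g} → (∀ i → i < n → f i ≡ g i) → ∑ n f ≡ ∑ n g
  ∑-cong zero    f≗g = refl
  ∑-cong (suc n) f≗g = cong₂ ℤ._+_ (f≗g 0 (s≤s z≤n)) (∑-cong n (λ i i<n → f≗g (suc i) (s≤s i<n)))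

  ∑-last : ∀ n f → ∑ (suc n) f ≡ ∑ n f ℤ.+ f n
  ∑-last zero    f = ℤ.+-comm (f 0) 0ℤ
  ∑-last (suc n) f = trans (cong (λ s → f 0 ℤ.+ s) (∑-last n (f ∘ suc))) (sym (ℤ.+-assoc (f 0) _ _))

  ∑-+ : ∀ n f g → ∑ n (λ i → f i ℤ.+ g i) ≡ ∑ n f ℤ.+ ∑ n g
  ∑-+ zero    f g = refl
  ∑-+ (suc n) f g = trans (cong (λ s → f 0 ℤ.+ g 0 ℤ.+ s) (∑-+ n (f ∘ suc) (g ∘ suc)))
                          (interchange (f 0) (g 0) _ _)
    where
    interchange : ∀ a b c d → a ℤ.+ b ℤ.+ (c ℤ.+ d) ≡ a ℤ.+ c ℤ.+ (b ℤ.+ d)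
    interchange = ℤ-Solver.solve-∀

  ∑-*ˡ : ∀ n c f → ∑ n (λ i → c ℤ.* f i) ≡ c ℤ.* ∑ n f
  ∑-*ˡ zero    c f = sym (ℤ.*-zeroʳ c)
  ∑-*ˡ (suc n) c f = trans (cong (λ s → c ℤ.* f 0 ℤ.+ s) (∑-*ˡ n c (f ∘ suc)))
                           (sym (ℤ.*-distribˡ-+ c (f 0) _))

opaque
  -- The summand receives the complementary index `n ∸ i` as an argument of its own, so that
  -- Pascal's rule raises exactly one of the two indices.
  binomialSum : ℕ → (ℕ → ℕ → ℤ) → ℤ
  binomialSum n f = ∑ (suc n) (λ i → + (n C i) ℤ.* f i (n ∸ i))

  binomialSum-def : ∀ n f → binomialSum n f ≡ ∑ (suc n) (λ i → + (n C i) ℤ.* f i (n ∸ i))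
  binomialSum-def n f = refl

  binomialSum-cong : ∀ n {f g} → (∀ i j → f i j ≡ g i j) → binomialSum n f ≡ binomialSum n g
  binomialSum-cong n f≗g = ∑-cong (suc n) (λ i _ → cong (λ x → + (n C i) ℤ.* x) (f≗g i (n ∸ i)))

  binomialSum-+ : ∀ n f g → binomialSum n (λ i j → f i j ℤ.+ g i j) ≡ binomialSum n f ℤ.+ binomialSum n g
  binomialSum-+ n f g = trans (∑-cong (suc n) (λ i _ → ℤ.*-distribˡ-+ (+ (n C i)) _ _)) (∑-+ (suc n) _ _)

  binomialSum-*ˡ : ∀ n c f → binomialSum n (λ i j → c ℤ.* f i j) ≡ c ℤ.* binomialSum n f
  binomialSum-*ˡ n c f = trans (∑-cong (suc n) (λ i _ → swap (+ (n C i)) c _)) (∑-*ˡ (suc n) c _)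
    where
    swap : ∀ a b x → a ℤ.* (b ℤ.* x) ≡ b ℤ.* (a ℤ.* x)
    swap = ℤ-Solver.solve-∀

  binomialSum-suc : ∀ n f →
    binomialSum (suc n) f ≡ binomialSum n (λ i j → f (suc i) j) ℤ.+ binomialSum n (λ i j → f i (suc j))
  binomialSum-suc n f = begin
    ∑ (suc (suc n)) h
      ≡⟨ ∑-first (suc n) h ⟩
    h 0 ℤ.+ ∑ (suc n) (h ∘ suc)
      ≡⟨ cong (λ s → h 0 ℤ.+ s) (trans (∑-cong (suc n) (λ i _ → pascal i)) (∑-+ (suc n) _ _)) ⟩
    h 0 ℤ.+ (A ℤ.+ ∑ (suc n) (λ i → + (n C suc i) ℤ.* f (suc i) (n ∸ i)))
      ≡⟨ move (h 0) A _ ⟩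
    A ℤ.+ (g 0 ℤ.+ ∑ (suc n) (g ∘ suc))
      ≡⟨ cong (λ s → A ℤ.+ s) (∑-first (suc n) g) ⟨
    A ℤ.+ ∑ (suc (suc n)) g
      -- The term i = n + 1 carries C(n, n+1) = 0, so the sum shrinks to the range of
      -- `binomialSum n`.
      ≡⟨ cong (λ s → A ℤ.+ s) (trans (∑-last (suc n) g) (trans (cong (λ s → ∑ (suc n) g ℤ.+ s) g-last) (ℤ.+-identityʳ _))) ⟩
    A ℤ.+ ∑ (suc n) g
      ≡⟨ cong (λ s → A ℤ.+ s) (∑-cong (suc n) (λ i i<1+n →
           cong (λ m → + (n C i) ℤ.* f i m) (∸-suc (≤-pred i<1+n)))) ⟩
    A ℤ.+ binomialSum n (λ i j → f i (suc j)) ∎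
    where
    h g : ℕ → ℤ
    h i = + (suc n C i) ℤ.* f i (suc n ∸ i)
    g i = + (n C i) ℤ.* f i (suc n ∸ i)
    A : ℤ
    A = binomialSum n (λ i j → f (suc i) j)
    ∸-suc : ∀ {i} → i ≤ n → suc n ∸ i ≡ suc (n ∸ i)
    ∸-suc i≤n = +-∸-assoc 1 i≤n
    pascal : ∀ i → h (suc i) ≡ + (n C i) ℤ.* f (suc i) (n ∸ i) ℤ.+ + (n C suc i) ℤ.* f (suc i) (n ∸ i)
    pascal i = trans (cong (λ c → + c ℤ.* f (suc i) (n ∸ i)) (sym (nCk+nC[k+1]≡[n+1]C[k+1] n i)))
                     (ℤ.*-distribʳ-+ (f (suc i) (n ∸ i)) (+ (n C i)) (+ (n C suc i)))
    g-last : g (suc n) ≡ 0ℤ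
    g-last = cong (λ c → + c ℤ.* f (suc n) (n ∸ n)) (k>n⇒nCk≡0 {n} {suc n} ≤-refl)
    move : ∀ a b c → a ℤ.+ (b ℤ.+ c) ≡ b ℤ.+ (a ℤ.+ c)
    move = ℤ-Solver.solve-∀

binomialSum-zero : ∀ f → binomialSum 0 f ≡ f 0 0
binomialSum-zero f = begin
  binomialSum 0 f      ≡⟨ binomialSum-def 0 f ⟩
  ∑ 1 g                ≡⟨ ∑-last 0 g ⟩
  ∑ 0 g ℤ.+ 1ℤ ℤ.* f 0 0 ≡⟨ cong₂ ℤ._+_ (∑-zero g) (ℤ.*-identityˡ (f 0 0)) ⟩
  0ℤ ℤ.+ f 0 0         ≡⟨ ℤ.+-identityˡ (f 0 0) ⟩
  f 0 0 ∎
  where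
  g : ℕ → ℤ
  g i = + (0 C i) ℤ.* f i (0 ∸ i)

-- Finite differences of yⁿ and Newton's expansion.

-- The k-th finite difference of y ↦ yⁿ at y = q, expanded about 0.
Δᵏ : ℕ → ℕ → ℕ → ℤ
Δᵏ q n k = binomialSum n (λ i j → (+ q) ℤ.^ i ℤ.* T j k)

Δᵏ-zero : ∀ q k → Δᵏ q 0 k ≡ T 0 k
Δᵏ-zero q k = trans (binomialSum-zero (λ i j → (+ q) ℤ.^ i ℤ.* T j k)) (ℤ.*-identityˡ _)

Δᵏ-suc : ∀ q n k → Δᵏ q (suc n) k ≡ + q ℤ.* Δᵏ q n k ℤ.+ binomialSum n (λ i j → (+ q) ℤ.^ i ℤ.* T (suc j) k)
Δᵏ-suc q n k = trans (binomialSum-suc n _) (cong (λ x → x ℤ.+ binomialSum n (λ i j → (+ q) ℤ.^ i ℤ.* T (suc j) k))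
  (trans (binomialSum-cong n (λ i j → ℤ.*-assoc (+ q) ((+ q) ℤ.^ i) (T j k))) (binomialSum-*ˡ n (+ q) _)))

Δᵏ-suc-zero : ∀ q n → Δᵏ q (suc n) 0 ≡ + q ℤ.* Δᵏ q n 0
Δᵏ-suc-zero q n = trans (Δᵏ-suc q n 0) (trans (cong (λ x → + q ℤ.* Δᵏ q n 0 ℤ.+ x) zeros) (ℤ.+-identityʳ _))
  where
  zeros : binomialSum n (λ i j → (+ q) ℤ.^ i ℤ.* T (suc j) 0) ≡ 0ℤ
  zeros = trans (binomialSum-cong n (λ i j → ℤ.*-comm ((+ q) ℤ.^ i) 0ℤ)) (binomialSum-*ˡ n 0ℤ (λ i j → (+ q) ℤ.^ i))

-- Leibniz rule for y · yⁿ: differencing the factor y leaves a k-th difference at q + 1, which is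
-- the bracket. It is inherited from `T-suc`, the same rule at 0.
Δᵏ-suc-suc : ∀ q n k → Δᵏ q (suc n) (suc k) ≡
  + q ℤ.* Δᵏ q n (suc k) ℤ.+ + suc k ℤ.* (Δᵏ q n (suc k) ℤ.+ Δᵏ q n k)
Δᵏ-suc-suc q n k = trans (Δᵏ-suc q n (suc k)) (cong (λ x → + q ℤ.* Δᵏ q n (suc k) ℤ.+ x) (begin
  binomialSum n (λ i j → (+ q) ℤ.^ i ℤ.* T (suc j) (suc k))
    ≡⟨ binomialSum-cong n (λ i j → trans (cong ((+ q) ℤ.^ i ℤ.*_) (T-suc j k))
         (distrib ((+ q) ℤ.^ i) (+ suc k) (T j (suc k)) (T j k))) ⟩
  binomialSum n (λ i j → + suc k ℤ.* ((+ q) ℤ.^ i ℤ.* T j (suc k) ℤ.+ (+ q) ℤ.^ i ℤ.* T j k))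
    ≡⟨ binomialSum-*ˡ n (+ suc k) _ ⟩
  + suc k ℤ.* binomialSum n (λ i j → (+ q) ℤ.^ i ℤ.* T j (suc k) ℤ.+ (+ q) ℤ.^ i ℤ.* T j k)
    ≡⟨ cong (+ suc k ℤ.*_) (binomialSum-+ n _ _) ⟩
  + suc k ℤ.* (Δᵏ q n (suc k) ℤ.+ Δᵏ q n k) ∎))
  where
  distrib : ∀ a c x y → a ℤ.* (c ℤ.* (x ℤ.+ y)) ≡ c ℤ.* (a ℤ.* x ℤ.+ a ℤ.* y)
  distrib = ℤ-Solver.solve-∀

-- This is g(q + 1) = g(q) + Δg(q) for g the k-th difference of yⁿ. As `Δᵏ` is an expansion about 0,
-- the proof is an induction on n in which both sides obey the Leibniz recursions.
Δᵏ-shift : ∀ q n k → Δᵏ (suc q) n k ≡ Δᵏ q n k ℤ.+ Δᵏ q n (suc k)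
Δᵏ-shift q zero k = begin
  Δᵏ (suc q) 0 k       ≡⟨ Δᵏ-zero (suc q) k ⟩
  T 0 k                ≡⟨ ℤ.+-identityʳ _ ⟨
  T 0 k ℤ.+ 0ℤ         ≡⟨ cong₂ ℤ._+_ (Δᵏ-zero q k) (trans (Δᵏ-zero q (suc k)) (T-zero-suc k)) ⟨
  Δᵏ q 0 k ℤ.+ Δᵏ q 0 (suc k) ∎
Δᵏ-shift q (suc n) zero = begin
  Δᵏ (suc q) (suc n) 0 ≡⟨ Δᵏ-suc-zero (suc q) n ⟩
  + suc q ℤ.* Δᵏ (suc q) n 0 ≡⟨ cong (+ suc q ℤ.*_) (Δᵏ-shift q n 0) ⟩
  + suc q ℤ.* (Δᵏ q n 0 ℤ.+ Δᵏ q n 1) ≡⟨ rearrange (+ q) (Δᵏ q n 0) (Δᵏ q n 1) ⟩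
  + q ℤ.* Δᵏ q n 0 ℤ.+ (+ q ℤ.* Δᵏ q n 1 ℤ.+ 1ℤ ℤ.* (Δᵏ q n 1 ℤ.+ Δᵏ q n 0))
    ≡⟨ cong₂ ℤ._+_ (Δᵏ-suc-zero q n) (Δᵏ-suc-suc q n 0) ⟨
  Δᵏ q (suc n) 0 ℤ.+ Δᵏ q (suc n) 1 ∎
  where
  rearrange : ∀ x a b → (1ℤ ℤ.+ x) ℤ.* (a ℤ.+ b) ≡ x ℤ.* a ℤ.+ (x ℤ.* b ℤ.+ 1ℤ ℤ.* (b ℤ.+ a))
  rearrange = ℤ-Solver.solve-∀
Δᵏ-shift q (suc n) (suc k) = begin
  Δᵏ (suc q) (suc n) (suc k) ≡⟨ Δᵏ-suc-suc (suc q) n k ⟩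
  + suc q ℤ.* Δᵏ (suc q) n (suc k) ℤ.+ + suc k ℤ.* (Δᵏ (suc q) n (suc k) ℤ.+ Δᵏ (suc q) n k)
    ≡⟨ cong₂ (λ u v → + suc q ℤ.* u ℤ.+ + suc k ℤ.* (u ℤ.+ v)) (Δᵏ-shift q n (suc k)) (Δᵏ-shift q n k) ⟩
  + suc q ℤ.* (b ℤ.+ c) ℤ.+ + suc k ℤ.* (b ℤ.+ c ℤ.+ (a ℤ.+ b))
    ≡⟨ rearrange (+ q) (+ suc k) a b c ⟩
  + q ℤ.* b ℤ.+ + suc k ℤ.* (b ℤ.+ a) ℤ.+ (+ q ℤ.* c ℤ.+ + suc (suc k) ℤ.* (c ℤ.+ b))
    ≡⟨ cong₂ ℤ._+_ (Δᵏ-suc-suc q n k) (Δᵏ-suc-suc q n (suc k)) ⟨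
  Δᵏ q (suc n) (suc k) ℤ.+ Δᵏ q (suc n) (suc (suc k)) ∎
  where
  a = Δᵏ q n k
  b = Δᵏ q n (suc k)
  c = Δᵏ q n (suc (suc k))
  rearrange : ∀ x y a b c → (1ℤ ℤ.+ x) ℤ.* (b ℤ.+ c) ℤ.+ y ℤ.* (b ℤ.+ c ℤ.+ (a ℤ.+ b)) ≡
    x ℤ.* b ℤ.+ y ℤ.* (b ℤ.+ a) ℤ.+ (x ℤ.* c ℤ.+ (1ℤ ℤ.+ y) ℤ.* (c ℤ.+ b))
  rearrange = ℤ-Solver.solve-∀

Δᵏ-at-0 : ∀ n k → Δᵏ 0 n k ≡ T n k
Δᵏ-at-0 zero    k       = Δᵏ-zero 0 k
Δᵏ-at-0 (suc n) zero    = Δᵏ-suc-zero 0 n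
Δᵏ-at-0 (suc n) (suc k) = begin
  Δᵏ 0 (suc n) (suc k) ≡⟨ Δᵏ-suc-suc 0 n k ⟩
  0ℤ ℤ.+ + suc k ℤ.* (Δᵏ 0 n (suc k) ℤ.+ Δᵏ 0 n k)
    ≡⟨ ℤ.+-identityˡ _ ⟩
  + suc k ℤ.* (Δᵏ 0 n (suc k) ℤ.+ Δᵏ 0 n k)
    ≡⟨ cong₂ (λ u v → + suc k ℤ.* (u ℤ.+ v)) (Δᵏ-at-0 n (suc k)) (Δᵏ-at-0 n k) ⟩
  + suc k ℤ.* (T n (suc k) ℤ.+ T n k) ≡⟨ T-suc n k ⟨
  T (suc n) (suc k) ∎

-- Both sides evaluate Δᵏ E^q yⁿ at 0: the left one writes the shift as E = 1 + Δ,
-- the right one expands (y + q)ⁿ.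
newton : ∀ q n k → binomialSum q (λ i _ → T n (k + i)) ≡ Δᵏ q n k
newton zero n k = begin
  binomialSum 0 (λ i _ → T n (k + i)) ≡⟨ binomialSum-zero _ ⟩
  T n (k + 0)               ≡⟨ cong (T n) (+-identityʳ k) ⟩
  T n k                     ≡⟨ Δᵏ-at-0 n k ⟨
  Δᵏ 0 n k ∎
newton (suc q) n k = begin
  binomialSum (suc q) (λ i _ → T n (k + i)) ≡⟨ binomialSum-suc q _ ⟩
  binomialSum q (λ i _ → T n (k + suc i)) ℤ.+ binomialSum q (λ i _ → T n (k + i))
    ≡⟨ cong₂ ℤ._+_ (trans (binomialSum-cong q (λ i _ → cong (T n) (+-suc k i))) (newton q n (suc k))) (newton q n k) ⟩
  Δᵏ q n (suc k) ℤ.+ Δᵏ q n k ≡⟨ ℤ.+-comm (Δᵏ q n (suc k)) _ ⟩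
  Δᵏ q n k ℤ.+ Δᵏ q n (suc k) ≡⟨ Δᵏ-shift q n k ⟨
  Δᵏ (suc q) n k ∎

-- Divisibility in the localisation of the integers at p.

abs-sign : ∀ i → ∃[ s ] (+ ℤ.∣ i ∣ ≡ s ℤ.* i × i ≡ s ℤ.* + ℤ.∣ i ∣)
abs-sign (+ n)      = 1ℤ , sym (ℤ.*-identityˡ (+ n)) , sym (ℤ.*-identityˡ (+ n))
abs-sign ℤ.-[1+ n ] = ℤ.-1ℤ , sym (ℤ.-1*i≡-i ℤ.-[1+ n ]) , sym (ℤ.-1*i≡-i (+ suc n))

^-monoʳ-∣ : ∀ m {a b} → a ≤ b → m ^ a ∣ m ^ b
^-monoʳ-∣ m {a} {b} a≤b = divides (m ^ (b ∸ a))
  (trans (cong (m ^_) (sym (m∸n+n≡m a≤b))) (^-distribˡ-+-* m (b ∸ a) a))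

infix 4 _∣[_]_ _~[_]_

-- Divisibility of integers in the localisation of ℤ at p.
record _∣[_]_ (m : ℤ) (p : ℕ) (x : ℤ) : Set where
  constructor fraction
  field
    denominator : ℕ
    numerator   : ℤ
    p∤denom     : ¬ p ∣ denominator
    equality    : + denominator ℤ.* x ≡ numerator ℤ.* m

-- Associates in the localisation, hence numbers of equal p-adic valuation. Signs are invisible, so
-- p and -p may be exchanged.
_~[_]_ : ℤ → ℕ → ℤ → Set
x ~[ p ] y = x ∣[ p ] y × y ∣[ p ] x

module _ {p : ℕ} (pr : Prime p) where

  p∤1 : ¬ p ∣ 1
  p∤1 p∣1 = ¬prime[1] (subst Prime (∣1⇒≡1 p∣1) pr)

  p∤* : ∀ {a b} → ¬ p ∣ a → ¬ p ∣ b → ¬ p ∣ a * b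
  p∤* {a} {b} p∤a p∤b p∣ab = [ p∤a , p∤b ]′ (euclidsLemma a b pr p∣ab)

  multiple : ∀ c {m} → m ∣[ p ] c ℤ.* m
  multiple c = fraction 1 c p∤1 (ℤ.*-identityˡ _)

  ∣ₚ-refl : ∀ {m} → m ∣[ p ] m
  ∣ₚ-refl {m} = fraction 1 1ℤ p∤1 refl

  ∣ₚ-reflexive : ∀ {m x} → m ≡ x → m ∣[ p ] x
  ∣ₚ-reflexive refl = ∣ₚ-refl

  ∣ₚ0 : ∀ {m} → m ∣[ p ] 0ℤ
  ∣ₚ0 = multiple 0ℤ

  1∣ₚ : ∀ x → 1ℤ ∣[ p ] x
  1∣ₚ x = fraction 1 x p∤1 (ℤ.*-comm 1ℤ x)

  ∣ₚ-trans : ∀ {x y z} → x ∣[ p ] y → y ∣[ p ] z → x ∣[ p ] z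
  ∣ₚ-trans {x} {y} {z} (fraction d u p∤d eq) (fraction d′ v p∤d′ eq′) =
    fraction (d * d′) (v ℤ.* u) (p∤* p∤d p∤d′) (begin
      + (d * d′) ℤ.* z     ≡⟨ cong (ℤ._* z) (ℤ.pos-* d d′) ⟩
      + d ℤ.* + d′ ℤ.* z   ≡⟨ ℤ.*-assoc (+ d) (+ d′) z ⟩
      + d ℤ.* (+ d′ ℤ.* z) ≡⟨ cong (+ d ℤ.*_) eq′ ⟩
      + d ℤ.* (v ℤ.* y)    ≡⟨ swap (+ d) v y ⟩
      v ℤ.* (+ d ℤ.* y)    ≡⟨ cong (v ℤ.*_) eq ⟩
      v ℤ.* (u ℤ.* x)      ≡⟨ ℤ.*-assoc v u x ⟨
      v ℤ.* u ℤ.* x ∎)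
    where
    swap : ∀ a b c → a ℤ.* (b ℤ.* c) ≡ b ℤ.* (a ℤ.* c)
    swap = ℤ-Solver.solve-∀

  ∣ₚ-+ : ∀ {m x y} → m ∣[ p ] x → m ∣[ p ] y → m ∣[ p ] x ℤ.+ y
  ∣ₚ-+ {m} {x} {y} (fraction d u p∤d eq) (fraction d′ v p∤d′ eq′) =
    fraction (d * d′) (+ d′ ℤ.* u ℤ.+ + d ℤ.* v) (p∤* p∤d p∤d′) (begin
      + (d * d′) ℤ.* (x ℤ.+ y)
        ≡⟨ cong (ℤ._* (x ℤ.+ y)) (ℤ.pos-* d d′) ⟩
      + d ℤ.* + d′ ℤ.* (x ℤ.+ y)
        ≡⟨ expand (+ d) (+ d′) x y ⟩
      + d′ ℤ.* (+ d ℤ.* x) ℤ.+ + d ℤ.* (+ d′ ℤ.* y)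
        ≡⟨ cong₂ (λ s t → + d′ ℤ.* s ℤ.+ + d ℤ.* t) eq eq′ ⟩
      + d′ ℤ.* (u ℤ.* m) ℤ.+ + d ℤ.* (v ℤ.* m)
        ≡⟨ collect (+ d) (+ d′) u v m ⟩
      (+ d′ ℤ.* u ℤ.+ + d ℤ.* v) ℤ.* m ∎)
    where
    expand : ∀ a b x y → a ℤ.* b ℤ.* (x ℤ.+ y) ≡ b ℤ.* (a ℤ.* x) ℤ.+ a ℤ.* (b ℤ.* y)
    expand = ℤ-Solver.solve-∀
    collect : ∀ a b u v m → b ℤ.* (u ℤ.* m) ℤ.+ a ℤ.* (v ℤ.* m) ≡ (b ℤ.* u ℤ.+ a ℤ.* v) ℤ.* m
    collect = ℤ-Solver.solve-∀

  ∣ₚ-* : ∀ {m n x y} → m ∣[ p ] x → n ∣[ p ] y → m ℤ.* n ∣[ p ] x ℤ.* y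
  ∣ₚ-* {m} {n} {x} {y} (fraction d u p∤d eq) (fraction d′ v p∤d′ eq′) =
    fraction (d * d′) (u ℤ.* v) (p∤* p∤d p∤d′) (begin
      + (d * d′) ℤ.* (x ℤ.* y)            ≡⟨ cong (ℤ._* (x ℤ.* y)) (ℤ.pos-* d d′) ⟩
      + d ℤ.* + d′ ℤ.* (x ℤ.* y)          ≡⟨ interchange (+ d) (+ d′) x y ⟩
      + d ℤ.* x ℤ.* (+ d′ ℤ.* y)          ≡⟨ cong₂ ℤ._*_ eq eq′ ⟩
      u ℤ.* m ℤ.* (v ℤ.* n)               ≡⟨ interchange u m v n ⟩
      u ℤ.* v ℤ.* (m ℤ.* n) ∎)
    where
    interchange : ∀ a b x y → a ℤ.* b ℤ.* (x ℤ.* y) ≡ a ℤ.* x ℤ.* (b ℤ.* y)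
    interchange = ℤ-Solver.solve-∀

  ∣ₚ-*ˡ : ∀ c {m x} → m ∣[ p ] x → m ∣[ p ] c ℤ.* x
  ∣ₚ-*ˡ c m∣x = ∣ₚ-trans m∣x (multiple c)

  ∣ₚ-neg : ∀ {m x} → m ∣[ p ] x → m ∣[ p ] ℤ.- x
  ∣ₚ-neg {m} {x} m∣x = subst (m ∣[ p ]_) (ℤ.-1*i≡-i x) (∣ₚ-*ˡ ℤ.-1ℤ m∣x)

  ∣ₚ-cancelˡ : ∀ c {m x} .{{_ : ℤ.NonZero c}} → c ℤ.* m ∣[ p ] c ℤ.* x → m ∣[ p ] x
  ∣ₚ-cancelˡ c {m} {x} (fraction d u p∤d eq) = fraction d u p∤d
    (ℤ.*-cancelˡ-≡ c _ _ (trans (swap c (+ d) x) (trans eq (swap u c m))))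
    where
    swap : ∀ a b y → a ℤ.* (b ℤ.* y) ≡ b ℤ.* (a ℤ.* y)
    swap = ℤ-Solver.solve-∀

  unit∣ₚ1 : ∀ {d} → ¬ p ∣ d → + d ∣[ p ] 1ℤ
  unit∣ₚ1 {d} p∤d = fraction d 1ℤ p∤d (ℤ.*-comm (+ d) 1ℤ)

  -- The way back to ordinary divisibility: the denominator is prime to p, so Euclid's lemma finds
  -- the factors p in `n`, one at a time.
  p^∣ₚ⇒p^∣ : ∀ v {n} → + (p ^ v) ∣[ p ] + n → p ^ v ∣ n
  p^∣ₚ⇒p^∣ v {n} (fraction d u p∤d eq) = cancel-unit v (divides ℤ.∣ u ∣ (begin
    d * n ≡⟨ ℤ.abs-* (+ d) (+ n) ⟨
    ℤ.∣ + d ℤ.* + n ∣ ≡⟨ cong ℤ.∣_∣ eq ⟩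
    ℤ.∣ u ℤ.* + (p ^ v) ∣ ≡⟨ ℤ.abs-* u (+ (p ^ v)) ⟩
    ℤ.∣ u ∣ * p ^ v ∎))
    where
    instance _ = prime⇒nonZero pr
    cancel-unit : ∀ v {n} → p ^ v ∣ d * n → p ^ v ∣ n
    cancel-unit zero {n} _ = ℕ∣.1∣ n
    cancel-unit (suc v) {n} pv∣dn with euclidsLemma d n pr (∣-trans (m∣m*n (p ^ v)) pv∣dn)
    ... | inj₁ p∣d = contradiction p∣d p∤d
    ... | inj₂ (divides m refl) = subst (p ^ suc v ∣_) (*-comm p m) (ℕ∣.*-monoʳ-∣ p
      (cancel-unit v (ℕ∣.*-cancelˡ-∣ p (subst (p ^ suc v ∣_) (rearrange d m p) pv∣dn))))
      where
      rearrange : ∀ d m p → d * (m * p) ≡ p * (d * m)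
      rearrange = ℕ-Solver.solve-∀

  p∣ₚ⇒p∣ : ∀ {n} → + p ∣[ p ] + n → p ∣ n
  p∣ₚ⇒p∣ {n} p∣n = subst (_∣ n) (*-identityʳ p)
    (p^∣ₚ⇒p^∣ 1 (subst (λ k → + k ∣[ p ] + n) (sym (*-identityʳ p)) p∣n))

  -- If x / m is congruent to a unit c modulo p, it is itself a unit. Without division: d (x - m c)
  -- = u m p gives (d c + u p) m = d x, and d c + u p is prime to p.
  residue-unit⇒∣ₚ : ∀ {m x c} → ¬ p ∣ c → m ℤ.* + p ∣[ p ] x ℤ.- m ℤ.* + c → x ∣[ p ] m
  residue-unit⇒∣ₚ {m} {x} {c} p∤c (fraction d u p∤d eq) =
    fraction ℤ.∣ w ∣ (+ d ℤ.* sgn) p∤w (begin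
      + ℤ.∣ w ∣ ℤ.* m         ≡⟨ cong (ℤ._* m) ∣w∣≡ ⟩
      sgn ℤ.* w ℤ.* m         ≡⟨ ℤ.*-assoc sgn w m ⟩
      sgn ℤ.* (w ℤ.* m)       ≡⟨ cong (sgn ℤ.*_) wm≡dx ⟩
      sgn ℤ.* (+ d ℤ.* x)     ≡⟨ rearrange sgn (+ d) x ⟩
      + d ℤ.* sgn ℤ.* x ∎)
    where
    w sgn : ℤ
    w = + d ℤ.* + c ℤ.+ u ℤ.* + p
    -- Denominators are natural numbers, so `w` enters through its absolute value and its sign moves
    -- to the numerator.
    sgn = proj₁ (abs-sign w)
    rearrange : ∀ s d x → s ℤ.* (d ℤ.* x) ≡ d ℤ.* s ℤ.* x
    rearrange = ℤ-Solver.solve-∀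
    wm≡dx : w ℤ.* m ≡ + d ℤ.* x
    wm≡dx = begin
      w ℤ.* m ≡⟨ split (+ d) (+ c) u (+ p) m ⟩
      + d ℤ.* (m ℤ.* + c) ℤ.+ u ℤ.* (m ℤ.* + p)
        ≡⟨ cong (λ s → + d ℤ.* (m ℤ.* + c) ℤ.+ s) eq ⟨
      + d ℤ.* (m ℤ.* + c) ℤ.+ + d ℤ.* (x ℤ.- m ℤ.* + c)
        ≡⟨ join (+ d) (m ℤ.* + c) x ⟩
      + d ℤ.* x ∎
      where
      split : ∀ d c u p m → (d ℤ.* c ℤ.+ u ℤ.* p) ℤ.* m ≡ d ℤ.* (m ℤ.* c) ℤ.+ u ℤ.* (m ℤ.* p)
      split = ℤ-Solver.solve-∀
      join : ∀ d y x → d ℤ.* y ℤ.+ d ℤ.* (x ℤ.- y) ≡ d ℤ.* x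
      join = ℤ-Solver.solve-∀
    ∣w∣≡ : + ℤ.∣ w ∣ ≡ sgn ℤ.* w
    ∣w∣≡ = proj₁ (proj₂ (abs-sign w))
    p∤w : ¬ p ∣ ℤ.∣ w ∣
    p∤w (divides t ∣w∣≡tp) = p∤* p∤d p∤c (p∣ₚ⇒p∣ (subst (+ p ∣[ p ]_) (begin
      w ℤ.+ ℤ.- (u ℤ.* + p) ≡⟨ drop (+ d ℤ.* + c) (u ℤ.* + p) ⟩
      + d ℤ.* + c           ≡⟨ ℤ.pos-* d c ⟨
      + (d * c) ∎)
      (∣ₚ-+ p∣w (∣ₚ-neg (multiple u)))))
      where
      p∣w : + p ∣[ p ] w
      p∣w = subst (+ p ∣[ p ]_) (sym (proj₂ (proj₂ (abs-sign w))))
        (∣ₚ-*ˡ sgn (subst (+ p ∣[ p ]_) (sym (trans (cong +_ ∣w∣≡tp) (ℤ.pos-* t p))) (multiple (+ t))))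
      drop : ∀ a b → (a ℤ.+ b) ℤ.+ ℤ.- b ≡ a
      drop = ℤ-Solver.solve-∀

  ~-refl : ∀ {x} → x ~[ p ] x
  ~-refl = ∣ₚ-refl , ∣ₚ-refl

  ~-sym : ∀ {x y} → x ~[ p ] y → y ~[ p ] x
  ~-sym (x∣y , y∣x) = y∣x , x∣y

  ~-trans : ∀ {x y z} → x ~[ p ] y → y ~[ p ] z → x ~[ p ] z
  ~-trans (x∣y , y∣x) (y∣z , z∣y) = ∣ₚ-trans x∣y y∣z , ∣ₚ-trans z∣y y∣x

  ~-* : ∀ {x y x′ y′} → x ~[ p ] x′ → y ~[ p ] y′ → x ℤ.* y ~[ p ] x′ ℤ.* y′
  ~-* (x∣x′ , x′∣x) (y∣y′ , y′∣y) = ∣ₚ-* x∣x′ y∣y′ , ∣ₚ-* x′∣x y′∣y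

  ~-^ : ∀ {x y} n → x ~[ p ] y → x ℤ.^ n ~[ p ] y ℤ.^ n
  ~-^ zero    x~y = ~-refl
  ~-^ (suc n) x~y = ~-* x~y (~-^ n x~y)

  ~-neg : ∀ {x} → x ~[ p ] ℤ.- x
  ~-neg {x} = ∣ₚ-neg ∣ₚ-refl , subst (ℤ.- x ∣[ p ]_) (ℤ.neg-involutive x) (∣ₚ-neg ∣ₚ-refl)

  unit~1 : ∀ {d} → ¬ p ∣ d → + d ~[ p ] 1ℤ
  unit~1 {d} p∤d = unit∣ₚ1 p∤d , 1∣ₚ (+ d)

  -- Otherwise p^(b+1) would divide p^b, and p would divide 1.
  p^-cancel-≤ : ∀ a b → + (p ^ a) ∣[ p ] + (p ^ b) → a ≤ b
  p^-cancel-≤ a b pa∣pb = ≮⇒≥ λ b<a → p∤1 (ℕ∣.*-cancelʳ-∣ (p ^ b) {{m^n≢0 p b}}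
    (subst₂ _∣_ refl (sym (*-identityˡ (p ^ b))) (∣-trans (^-monoʳ-∣ p b<a) (p^∣ₚ⇒p^∣ a pa∣pb))))
    where instance _ = prime⇒nonZero pr

  ∣ₚ-∑ : ∀ n {m f} → (∀ i → i < n → m ∣[ p ] f i) → m ∣[ p ] ∑ n f
  ∣ₚ-∑ zero    {f = f} m∣f = subst (_ ∣[ p ]_) (sym (∑-zero f)) ∣ₚ0
  ∣ₚ-∑ (suc n) {f = f} m∣f = subst (_ ∣[ p ]_) (sym (∑-first n f))
    (∣ₚ-+ (m∣f 0 (s≤s z≤n)) (∣ₚ-∑ n (λ i i<n → m∣f (suc i) (s≤s i<n))))

-- Boundary values of S, binomial identities and a recursion lowering k.

S-above : ∀ {n k} → n < k → S n k ≡ 0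
S-above {zero}  {suc k} _ = refl
S-above {suc n} {suc k} (s≤s n<k) = begin
  suc k * S n (suc k) + S n k ≡⟨ cong₂ (λ x y → suc k * x + y) (S-above (m<n⇒m<1+n n<k)) (S-above n<k) ⟩
  suc k * 0 + 0               ≡⟨ cong (_+ 0) (*-zeroʳ (suc k)) ⟩
  0 ∎

S-diagonal : ∀ k → S k k ≡ 1
S-diagonal zero    = refl
S-diagonal (suc k) = begin
  suc k * S k (suc k) + S k k ≡⟨ cong₂ (λ x y → suc k * x + y) (S-above (n<1+n k)) (S-diagonal k) ⟩
  suc k * 0 + 1               ≡⟨ cong (_+ 1) (*-zeroʳ (suc k)) ⟩
  1 ∎

T-above : ∀ {n k} → n < k → T n k ≡ 0ℤ
T-above {n} {k} n<k = cong +_ (trans (cong (k ! *_) (S-above n<k)) (*-zeroʳ (k !)))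

T-diagonal : ∀ k → T k k ≡ + (k !)
T-diagonal k = cong +_ (trans (cong (k ! *_) (S-diagonal k)) (*-identityʳ (k !)))

nCk*k![n∸k]!≡n! : ∀ {n k} → k ≤ n → (n C k) * (k ! * (n ∸ k) !) ≡ n !
nCk*k![n∸k]!≡n! {n} {k} k≤n = trans (cong (_* (k ! * (n ∸ k) !)) (nCk≡n!/k![n-k]! k≤n))
  (m/n*n≡m (k![n∸k]!∣n! k≤n))
  where instance _ = k !* (n ∸ k) !≢0

[k+1]*[n+1]C[k+1]≡[n+1]*nCk : ∀ n k → suc k * (suc n C suc k) ≡ suc n * (n C k)
[k+1]*[n+1]C[k+1]≡[n+1]*nCk n k with k ≤? n
... | no k≰n = begin
  suc k * (suc n C suc k) ≡⟨ cong (suc k *_) (k>n⇒nCk≡0 (s≤s (≰⇒> k≰n))) ⟩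
  suc k * 0               ≡⟨ *-zeroʳ (suc k) ⟩
  0                       ≡⟨ *-zeroʳ (suc n) ⟨
  suc n * 0               ≡⟨ cong (suc n *_) (k>n⇒nCk≡0 (≰⇒> k≰n)) ⟨
  suc n * (n C k) ∎
... | yes k≤n = *-cancelʳ-≡ _ _ (k ! * (n ∸ k) !) (begin
  suc k * (suc n C suc k) * (k ! * (n ∸ k) !) ≡⟨ rearrange (suc k) (suc n C suc k) (k !) ((n ∸ k) !) ⟩
  (suc n C suc k) * (suc k ! * (n ∸ k) !)       ≡⟨ nCk*k![n∸k]!≡n! (s≤s k≤n) ⟩
  suc n * n !                                 ≡⟨ cong (suc n *_) (nCk*k![n∸k]!≡n! k≤n) ⟨
  suc n * ((n C k) * (k ! * (n ∸ k) !))         ≡⟨ *-assoc (suc n) (n C k) _ ⟨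
  suc n * (n C k) * (k ! * (n ∸ k) !) ∎)
  where
  instance _ = k !* (n ∸ k) !≢0
  rearrange : ∀ c b x y → c * b * (x * y) ≡ b * (c * x * y)
  rearrange = ℕ-Solver.solve-∀

-- The operator identity Δ^(k+1) = Δ^k (E - 1) at 0: the power (y + 1)ⁿ is expanded and its term i =
-- 0 cancels against `T n k`.
T-suc-∑ : ∀ n k → T n (suc k) ≡ ∑ n (λ i → + (n C suc i) ℤ.* T (n ∸ suc i) k)
T-suc-∑ n k = ℤ+.∙-cancelˡ (T n k) _ _ (begin
  T n k ℤ.+ T n (suc k)             ≡⟨ cong₂ ℤ._+_ (Δᵏ-at-0 n k) (Δᵏ-at-0 n (suc k)) ⟨
  Δᵏ 0 n k ℤ.+ Δᵏ 0 n (suc k)       ≡⟨ Δᵏ-shift 0 n k ⟨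
  Δᵏ 1 n k                          ≡⟨ trans (binomialSum-def n _) (∑-first n _) ⟩
  1ℤ ℤ.* (1ℤ ℤ.* T n k) ℤ.+ ∑ n (λ i → + (n C suc i) ℤ.* (1ℤ ℤ.^ suc i ℤ.* T (n ∸ suc i) k))
    ≡⟨ cong₂ ℤ._+_ (trans (ℤ.*-identityˡ (1ℤ ℤ.* T n k)) (ℤ.*-identityˡ (T n k))) (∑-cong n (λ i _ →
         cong (λ x → + (n C suc i) ℤ.* x) (trans (cong (λ x → x ℤ.* T (n ∸ suc i) k) (ℤ.^-zeroˡ (suc i))) (ℤ.*-identityˡ _)))) ⟩
  T n k ℤ.+ ∑ n (λ i → + (n C suc i) ℤ.* T (n ∸ suc i) k) ∎)

-- Base-p digit sums.

module _ (p : ℕ) .{{_ : NonZero p}} (1<p : 1 < p) where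

  suc/≤ : ∀ m → suc m / p ≤ m
  suc/≤ m = ≤-pred (m/n<m (suc m) p 1<p)

  -- One step of `σ p (suc m)` leaves fuel `m` for the quotient, whereas `σ` of the quotient takes
  -- the quotient itself as fuel.
  digitSumFuel-stable : ∀ f g m → m ≤ f → m ≤ g → digitSumFuel f p m ≡ digitSumFuel g p m
  digitSumFuel-stable zero    zero    zero    _ _ = refl
  digitSumFuel-stable zero    (suc g) zero    _ _ = refl
  digitSumFuel-stable (suc f) zero    zero    _ _ = refl
  digitSumFuel-stable (suc f) (suc g) zero    _ _ = refl
  digitSumFuel-stable (suc f) (suc g) (suc m) (s≤s m≤f) (s≤s m≤g) = cong (λ s → suc m % p + s)
    (digitSumFuel-stable f g (suc m / p) (≤-trans (suc/≤ m) m≤f) (≤-trans (suc/≤ m) m≤g))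

  σ-rec : ∀ m → σ p m ≡ m % p + σ p (m / p)
  σ-rec zero    = sym (cong₂ _+_ (m<n⇒m%n≡m (<-trans (s≤s z≤n) 1<p)) (cong (σ p) (0/n≡0 p)))
  σ-rec (suc m) = cong (λ s → suc m % p + s) (digitSumFuel-stable m (suc m / p) (suc m / p) (suc/≤ m) ≤-refl)

  σ-digit : ∀ {a} → a < p → σ p a ≡ a
  σ-digit {a} a<p = begin
    σ p a               ≡⟨ σ-rec a ⟩
    a % p + σ p (a / p) ≡⟨ cong₂ (λ x y → x + σ p y) (m<n⇒m%n≡m a<p) (m<n⇒m/n≡0 a<p) ⟩
    a + 0               ≡⟨ +-identityʳ a ⟩
    a ∎

  σ-* : ∀ m → σ p (m * p) ≡ σ p m
  σ-* m = trans (σ-rec (m * p)) (cong₂ (λ x y → x + σ p y) (m*n%n≡0 m p) (m*n/n≡m m p))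

  σ-*^ : ∀ {a} → a < p → ∀ h → σ p (a * p ^ h) ≡ a
  σ-*^ {a} a<p zero    = trans (cong (σ p) (*-identityʳ a)) (σ-digit a<p)
  σ-*^ {a} a<p (suc h) = begin
    σ p (a * (p * p ^ h)) ≡⟨ cong (σ p) (rearrange a p (p ^ h)) ⟩
    σ p (a * p ^ h * p)   ≡⟨ σ-* (a * p ^ h) ⟩
    σ p (a * p ^ h)       ≡⟨ σ-*^ a<p h ⟩
    a ∎
    where
    rearrange : ∀ a p x → a * (p * x) ≡ a * x * p
    rearrange = ℕ-Solver.solve-∀

  -- If the last digit is 0, the quotient by p is nonzero and smaller, so induction applies.
  -- Positivity makes the Legendre estimate (p - 1) ν < i for i! strict.
  σ-positive : ∀ m → 1 ≤ m → 1 ≤ σ p m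
  σ-positive = <-rec _ λ
    { (suc m) rec _ → subst (1 ≤_) (sym (σ-rec (suc m))) (step m rec (suc m % p) refl) }
    where
    step : ∀ m → (∀ {n} → n < suc m → 1 ≤ n → 1 ≤ σ p n) → ∀ c → suc m % p ≡ c → 1 ≤ suc m % p + σ p (suc m / p)
    step m rec (suc c) eq = ≤-trans (subst (1 ≤_) (sym eq) (s≤s z≤n)) (m≤m+n _ _)
    step m rec zero eq = ≤-trans (rec (s≤s (suc/≤ m)) (n≢0⇒n>0 λ sm/p≡0 → 0≢1+n (begin
      0                         ≡⟨ cong₂ (λ x y → x + y * p) eq sm/p≡0 ⟨
      suc m % p + suc m / p * p ≡⟨ m≡m%n+[m/n]*n (suc m) p ⟨
      suc m ∎))) (m≤n+m _ _)

-- Legendre's formula up to units at p.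

module AtPrime (r : ℕ) (pr : Prime (suc (suc r))) where

  p q : ℕ
  q = suc r
  p = suc q

  -- With -p in place of p, the recurrence for T becomes Pascal's rule without alternating signs.
  π : ℤ
  π = ℤ.- + p

  1<p : 1 < p
  1<p = s≤s (s≤s z≤n)

  p~π : + p ~[ p ] π
  p~π = ~-neg pr

  p∤small : ∀ {c} → suc c < p → ¬ p ∣ suc c
  p∤small c<p = ℕ∣.>⇒∤ c<p

  -- Factors peel off one by one: c + m p with 0 < c < p is a unit, while c = 0 leaves m p, which
  -- contributes one `π` to the power and m to m!.
  [c+mp]!~π^m*m! : ∀ m c → c < p → + ((c + m * p) !) ~[ p ] π ℤ.^ m ℤ.* + (m !)
  [c+mp]!~π^m*m! zero    zero    _ = ~-refl pr
  [c+mp]!~π^m*m! (suc m) zero    _ = subst₂ _~[ p ]_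
    (sym (trans (cong +_ (cong (_* (q + m * p) !) (*-comm (suc m) p))) (trans (ℤ.pos-* (p * suc m) _)
      (cong (λ s → s ℤ.* + ((q + m * p) !)) (ℤ.pos-* p (suc m))))))
    (trans (rearrange π (+ suc m) (π ℤ.^ m) (+ (m !))) (cong (λ s → π ℤ.^ suc m ℤ.* s) (sym (ℤ.pos-* (suc m) (m !)))))
    (~-* pr {+ p ℤ.* + suc m} {+ ((q + m * p) !)} (~-* pr p~π (~-refl pr {+ suc m})) ([c+mp]!~π^m*m! m q ≤-refl))
    where
    rearrange : ∀ π n x y → π ℤ.* n ℤ.* (x ℤ.* y) ≡ π ℤ.* x ℤ.* (n ℤ.* y)
    rearrange = ℤ-Solver.solve-∀
  [c+mp]!~π^m*m! m (suc c) c<p = subst₂ _~[ p ]_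
    (sym (ℤ.pos-* (suc (c + m * p)) _)) (ℤ.*-identityˡ _)
    (~-* pr (unit~1 pr λ p∣ → p∤small c<p (ℕ∣.∣m+n∣m⇒∣n (subst (p ∣_) (+-comm (suc c) (m * p)) p∣) (n∣m*n m)))
      ([c+mp]!~π^m*m! m c (<-trans (n<1+n c) c<p)))

  -- Here `ν` is the valuation of k!, computed by strong induction from k! ~ p^m m! with m = k / p.
  -- The formula is additive, which avoids truncated subtraction.
  legendre : ∀ k → ∃[ ν ] (q * ν + σ p k ≡ k × + (k !) ~[ p ] π ℤ.^ ν)
  legendre = <-rec _ step
    where
    step : ∀ k → (∀ {m} → m < k → ∃[ ν ] (q * ν + σ p m ≡ m × + (m !) ~[ p ] π ℤ.^ ν)) →
           ∃[ ν ] (q * ν + σ p k ≡ k × + (k !) ~[ p ] π ℤ.^ ν)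
    step zero    _   = 0 , trans (+-identityʳ (q * 0)) (*-zeroʳ q) , ~-refl pr
    step (suc k) rec with rec (s≤s (suc/≤ p 1<p k))
    ... | ν , eq , m!~π^ν = m + ν , weight , subst₂ _~[ p ]_
      (cong (λ n → + (n !)) (sym (m≡m%n+[m/n]*n (suc k) p))) (sym (ℤ.^-distribˡ-+-* π m ν))
      (~-trans pr ([c+mp]!~π^m*m! m (suc k % p) (m%n<n (suc k) p)) (~-* pr (~-refl pr {π ℤ.^ m}) m!~π^ν))
      where
      m = suc k / p
      weight : q * (m + ν) + σ p (suc k) ≡ suc k
      weight = begin
        q * (m + ν) + σ p (suc k)               ≡⟨ cong (λ s → q * (m + ν) + s) (σ-rec p 1<p (suc k)) ⟩
        q * (m + ν) + (suc k % p + σ p m)       ≡⟨ regroup q m ν (suc k % p) (σ p m) ⟩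
        suc k % p + (q * ν + σ p m + q * m)     ≡⟨ cong (λ s → suc k % p + (s + q * m)) eq ⟩
        suc k % p + (m + q * m)                 ≡⟨ cong (λ s → suc k % p + s) (*-comm p m) ⟩
        suc k % p + m * p                       ≡⟨ m≡m%n+[m/n]*n (suc k) p ⟨
        suc k ∎
        where
        regroup : ∀ q m ν c s → q * (m + ν) + (c + s) ≡ c + (q * ν + s + q * m)
        regroup = ℕ-Solver.solve-∀

  -- Integrality at p of (-p)^e T(n,k) / n!.

  π^-mono : ∀ {a b} → a ≤ b → π ℤ.^ a ∣[ p ] π ℤ.^ b
  π^-mono {a} {b} a≤b = subst (π ℤ.^ a ∣[ p ]_)
    (trans (sym (ℤ.^-distribˡ-+-* π (b ∸ a) a)) (cong (π ℤ.^_) (m∸n+n≡m a≤b)))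
    (multiple pr (π ℤ.^ (b ∸ a)))

  -- Legendre's formula and σ(i) ≥ 1 give (p - 1) ν < i ≤ (p - 1)(t + 1), hence ν ≤ t.
  factorial∣π^ : ∀ t {i} → 1 ≤ i → i ≤ q * suc t → + (i !) ∣[ p ] π ℤ.^ t
  factorial∣π^ t {i} 1≤i i≤ with legendre i
  ... | ν , eq , i!~π^ν = ∣ₚ-trans pr (proj₁ i!~π^ν) (π^-mono (≤-pred (*-cancelˡ-< q ν (suc t)
    (<-≤-trans (m<m+n (q * ν) (σ-positive p 1<p i 1≤i)) (≤-trans (≤-reflexive eq) i≤)))))

  -- From C(n,i) i! (n-i)! = n!. The spare factor `m` is 1 for integrality and p for the error
  -- estimate.
  binomial-term : ∀ {n i m x y} → i ≤ n → + (i !) ℤ.* m ∣[ p ] x → + ((n ∸ i) !) ∣[ p ] y →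
                  + (n !) ℤ.* m ∣[ p ] + (n C i) ℤ.* (x ℤ.* y)
  binomial-term {n} {i} {m} {x} {y} i≤n i!m∣x j!∣y = subst (_∣[ p ] + (n C i) ℤ.* (x ℤ.* y))
    (begin
      + (n C i) ℤ.* (+ (i !) ℤ.* m ℤ.* + ((n ∸ i) !))
        ≡⟨ rearrange (+ (n C i)) (+ (i !)) m (+ ((n ∸ i) !)) ⟩
      + (n C i) ℤ.* (+ (i !) ℤ.* + ((n ∸ i) !)) ℤ.* m
        ≡⟨ cong (λ s → + (n C i) ℤ.* s ℤ.* m) (ℤ.pos-* (i !) ((n ∸ i) !)) ⟨
      + (n C i) ℤ.* + (i ! * (n ∸ i) !) ℤ.* m
        ≡⟨ cong (ℤ._* m) (trans (sym (ℤ.pos-* (n C i) (i ! * (n ∸ i) !))) (cong +_ (nCk*k![n∸k]!≡n! i≤n))) ⟩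
      + (n !) ℤ.* m ∎)
    (∣ₚ-* pr (∣ₚ-refl pr {+ (n C i)}) (∣ₚ-* pr i!m∣x j!∣y))
    where
    rearrange : ∀ c a m b → c ℤ.* (a ℤ.* m ℤ.* b) ≡ c ℤ.* (a ℤ.* b) ℤ.* m
    rearrange = ℤ-Solver.solve-∀

  -- Induction on k through `T-suc-∑`. In the i-th summand the powers of `π` are shared out: floor(i
  -- / (p - 1)) of them clear (i+1)!, and the others serve `T (n ∸ suc i) k`.
  n!∣π^e*T : ∀ k n e → n < k + q * suc e → + (n !) ∣[ p ] π ℤ.^ e ℤ.* T n k
  n!∣π^e*T zero    zero    e _ = 1∣ₚ pr _
  n!∣π^e*T zero    (suc n) e _ = subst (+ (suc n !) ∣[ p ]_) (sym (ℤ.*-zeroʳ (π ℤ.^ e))) (∣ₚ0 pr)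
  n!∣π^e*T (suc k) n       e n< = subst (+ (n !) ∣[ p ]_)
    (trans (∑-*ˡ n (π ℤ.^ e) term) (cong (π ℤ.^ e ℤ.*_) (sym (T-suc-∑ n k))))
    (∣ₚ-∑ pr n divisible)
    where
    term : ℕ → ℤ
    term i = + (n C suc i) ℤ.* T (n ∸ suc i) k
    divisible : ∀ i → i < n → + (n !) ∣[ p ] π ℤ.^ e ℤ.* term i
    divisible i i<n with i / q ≤? e
    -- Here (p - 1)(e + 1) ≤ i, which forces n - (i + 1) < k, so T vanishes.
    ... | no i/q≰e = subst (+ (n !) ∣[ p ]_)
      (sym (trans (cong (λ x → π ℤ.^ e ℤ.* (+ (n C suc i) ℤ.* x)) (T-above j<k))
        (trans (cong (π ℤ.^ e ℤ.*_) (ℤ.*-zeroʳ (+ (n C suc i)))) (ℤ.*-zeroʳ (π ℤ.^ e))))) (∣ₚ0 pr)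
      where
      j<k : n ∸ suc i < k
      j<k = +-cancelˡ-< (suc i) _ _ (≤-<-trans (≤-reflexive (m+[n∸m]≡n i<n)) (<-≤-trans n<
        (s≤s (≤-trans (+-monoʳ-≤ k (≤-trans (*-monoʳ-≤ q (≰⇒> i/q≰e))
          (≤-trans (≤-reflexive (*-comm q (i / q))) (m/n*n≤m i q))))
          (≤-reflexive (+-comm k i))))))
    ... | yes t≤e = subst₂ _∣[ p ]_ (ℤ.*-identityʳ (+ (n !)))
      (trans (cong (+ (n C suc i) ℤ.*_) (trans (sym (ℤ.*-assoc (π ℤ.^ t) (π ℤ.^ (e ∸ t)) (T (n ∸ suc i) k)))
          (cong (ℤ._* T (n ∸ suc i) k) (trans (sym (ℤ.^-distribˡ-+-* π t (e ∸ t))) (cong (π ℤ.^_) (m+[n∸m]≡n t≤e))))))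
        (swap (+ (n C suc i)) (π ℤ.^ e) (T (n ∸ suc i) k)))
      (binomial-term {n} {suc i} {1ℤ} i<n
        (subst (_∣[ p ] π ℤ.^ t) (sym (ℤ.*-identityʳ (+ (suc i !)))) (factorial∣π^ t (s≤s z≤n) i<q*[1+t]))
        (n!∣π^e*T k (n ∸ suc i) (e ∸ t) j<))
      where
      t = i / q
      swap : ∀ a b x → a ℤ.* (b ℤ.* x) ≡ b ℤ.* (a ℤ.* x)
      swap = ℤ-Solver.solve-∀
      i<q*[1+t] : i < q * suc t
      i<q*[1+t] = subst₂ _<_ (sym (m≡m%n+[m/n]*n i q)) (*-comm (suc t) q) (+-monoˡ-< (t * q) (m%n<n i q))
      j< : n ∸ suc i < k + q * suc (e ∸ t)
      j< = +-cancelˡ-< (suc i) _ _ (≤-<-trans (≤-reflexive (m+[n∸m]≡n i<n)) (<-≤-trans n< (s≤s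
        (≤-trans (≤-reflexive (trans (cong (λ x → k + q * suc x) (sym (m+[n∸m]≡n t≤e))) (regroup k r t (e ∸ t))))
          (+-monoˡ-≤ (k + q * suc (e ∸ t)) (m/n*n≤m i q))))))
        where
        regroup : ∀ k r t s → k + suc r * suc (t + s) ≡ t * suc r + (k + suc r * suc s)
        regroup = ℕ-Solver.solve-∀

  -- Pascal's rule modulo p.

  p∣pC[1+i] : ∀ {i} → suc i < p → p ∣ p C suc i
  p∣pC[1+i] {i} i<p with euclidsLemma (suc i) (p C suc i) pr
    (divides (q C i) (trans ([k+1]*[n+1]C[k+1]≡[n+1]*nCk q i) (*-comm p (q C i))))
  ... | inj₁ p∣1+i = contradiction p∣1+i (p∤small i<p)
  ... | inj₂ p∣C   = p∣C

  -- This settles k = 0 in `T-mod-p`, where T vanishes. In the absorption identity `suc e` occurs on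
  -- both sides and cancels, leaving p.
  p∣[p*n]Cn : ∀ e → p ∣ (p * suc e) C suc e
  p∣[p*n]Cn e = divides (N C e) (*-cancelˡ-≡ _ _ (suc e) (begin
    suc e * ((p * suc e) C suc e) ≡⟨ [k+1]*[n+1]C[k+1]≡[n+1]*nCk N e ⟩
    p * suc e * (N C e)           ≡⟨ rearrange p (suc e) (N C e) ⟩
    suc e * ((N C e) * p) ∎))
    where
    N = e + q * suc e
    rearrange : ∀ p s c → p * s * c ≡ s * (c * p)
    rearrange = ℕ-Solver.solve-∀

  ∣⇒∣ₚ : ∀ {n} → p ∣ n → + p ∣[ p ] + n
  ∣⇒∣ₚ (divides t refl) = subst (+ p ∣[ p ]_) (sym (ℤ.pos-* t p)) (multiple pr (+ t))

  module MainStep (k n e : ℕ) (n≡ : suc n ≡ k + p + q * e) where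
    -- The error terms: `E₁` collects 2 ≤ i ≤ p - 1 in the expansion of (1 + Δ)^p, and `E₂` collects
    -- i ≥ 2 in that of (y + p)^(n+1).
    P E₁ E₂ : ℤ
    P  = π ℤ.^ e
    E₁ = ∑ r (λ i → + (p C (2 + i)) ℤ.* T (suc n) (k + (2 + i)))
    E₂ = ∑ n (λ i → + (suc n C (2 + i)) ℤ.* ((+ p) ℤ.^ (2 + i) ℤ.* T (suc n ∸ (2 + i)) k))

    n≡′ : suc n ≡ suc (k + q * suc e)
    n≡′ = trans n≡ (regroup k r e)
      where
      regroup : ∀ k r e → k + suc (suc r) + suc r * e ≡ suc (k + suc r * suc e)
      regroup = ℕ-Solver.solve-∀

    lhs : binomialSum p (λ i _ → T (suc n) (k + i)) ≡
      T (suc n) k ℤ.+ (+ p ℤ.* T (suc n) (suc k) ℤ.+ (E₁ ℤ.+ T (suc n) (k + p)))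
    lhs = begin
      binomialSum p (λ i _ → T (suc n) (k + i)) ≡⟨ binomialSum-def p _ ⟩
      ∑ (suc p) f ≡⟨ trans (∑-first p f) (cong (λ s → f 0 ℤ.+ s) (trans (∑-first q (f ∘ suc))
                       (cong (λ s → f 1 ℤ.+ s) (∑-last r (λ i → f (2 + i)))))) ⟩
      f 0 ℤ.+ (f 1 ℤ.+ (E₁ ℤ.+ f p))
        ≡⟨ cong₂ ℤ._+_ (trans (ℤ.*-identityˡ (T (suc n) (k + 0))) (cong (T (suc n)) (+-identityʳ k)))
             (cong₂ ℤ._+_ (cong₂ (λ c m → + c ℤ.* T (suc n) m) (nC1≡n p) (+-comm k 1))
               (cong (λ s → E₁ ℤ.+ s) (trans (cong (λ c → + c ℤ.* T (suc n) (k + p)) (nCn≡1 p))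
                 (ℤ.*-identityˡ (T (suc n) (k + p)))))) ⟩
      _ ∎
      where
      f : ℕ → ℤ
      f i = + (p C i) ℤ.* T (suc n) (k + i)

    rhs : Δᵏ p (suc n) k ≡ T (suc n) k ℤ.+ (+ suc n ℤ.* (+ p ℤ.* T n k) ℤ.+ E₂)
    rhs = begin
      Δᵏ p (suc n) k ≡⟨ binomialSum-def (suc n) _ ⟩
      ∑ (suc (suc n)) f ≡⟨ trans (∑-first (suc n) f) (cong (λ s → f 0 ℤ.+ s) (∑-first n (f ∘ suc))) ⟩
      f 0 ℤ.+ (f 1 ℤ.+ E₂)
        ≡⟨ cong₂ ℤ._+_ (trans (ℤ.*-identityˡ (1ℤ ℤ.* T (suc n) k)) (ℤ.*-identityˡ (T (suc n) k)))
             (cong (ℤ._+ E₂) (cong₂ (λ c x → + c ℤ.* (x ℤ.* T n k)) (nC1≡n (suc n)) (ℤ.*-identityʳ (+ p)))) ⟩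
      _ ∎
      where
      f : ℕ → ℤ
      f i = + (suc n C i) ℤ.* ((+ p) ℤ.^ i ℤ.* T (suc n ∸ i) k)

    -- The factor p comes from C(p,i). As n + 1 = k + 1 + (p - 1)(e + 1), the exponent e meets the
    -- integrality bound at k + i once i ≥ 2. At i = 1 the bound asks for e + 1, so that term stays
    -- in the main part.
    p*n!∣P*E₁ : + (suc n !) ℤ.* + p ∣[ p ] P ℤ.* E₁
    p*n!∣P*E₁ = subst (+ (suc n !) ℤ.* + p ∣[ p ]_) (∑-*ˡ r P _) (∣ₚ-∑ pr r λ i i<r →
      subst₂ _∣[ p ]_ (ℤ.*-comm (+ p) (+ (suc n !))) (swap (+ (p C (2 + i))) P (T (suc n) (k + (2 + i))))
        (∣ₚ-* pr {+ p} {+ (suc n !)} {+ (p C (2 + i))} {P ℤ.* T (suc n) (k + (2 + i))}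
          (∣⇒∣ₚ (p∣pC[1+i] (s≤s (s≤s i<r))))
          (n!∣π^e*T (k + (2 + i)) (suc n) e (bound i))))
      where
      swap : ∀ a b x → a ℤ.* (b ℤ.* x) ≡ b ℤ.* (a ℤ.* x)
      swap = ℤ-Solver.solve-∀
      bound : ∀ i → suc n < k + (2 + i) + q * suc e
      bound i = ≤-trans (≤-trans (≤-reflexive (cong suc n≡′)) (m≤m+n _ i)) (≤-reflexive (regroup k i (q * suc e)))
        where
        regroup : ∀ k i x → suc (suc (k + x)) + i ≡ k + (2 + i) + x
        regroup = ℕ-Solver.solve-∀

    -- Of p^i with i ≥ 2, one p is the gain and p^(i-1) is a multiple of i! in the localisation.
    -- Lowering n + 1 by at least 2 lets the exponent e meet the integrality bound.
    p*n!∣P*E₂ : + (suc n !) ℤ.* + p ∣[ p ] P ℤ.* E₂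
    p*n!∣P*E₂ = subst (+ (suc n !) ℤ.* + p ∣[ p ]_) (∑-*ˡ n P _) (∣ₚ-∑ pr n λ i i<n →
      subst (+ (suc n !) ℤ.* + p ∣[ p ]_)
        (swap (+ (suc n C (2 + i))) ((+ p) ℤ.^ (2 + i)) P (T (suc n ∸ (2 + i)) k))
        (binomial-term {suc n} {2 + i} {+ p} {(+ p) ℤ.^ (2 + i)} {P ℤ.* T (suc n ∸ (2 + i)) k} (s≤s i<n)
          (subst (_∣[ p ] (+ p) ℤ.^ (2 + i)) (ℤ.*-comm (+ p) (+ ((2 + i) !)))
            (∣ₚ-* pr {+ p} {+ ((2 + i) !)} {+ p} {(+ p) ℤ.^ (1 + i)} (∣ₚ-refl pr)
              (∣ₚ-trans pr (factorial∣π^ (1 + i) (s≤s z≤n) (m≤m+n (2 + i) (r * (2 + i))))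
                (proj₂ (~-^ pr {+ p} {π} (1 + i) p~π)))))
          (n!∣π^e*T k (suc n ∸ (2 + i)) e (bound i (s≤s i<n)))))
      where
      swap : ∀ a b c x → a ℤ.* (b ℤ.* (c ℤ.* x)) ≡ c ℤ.* (a ℤ.* (b ℤ.* x))
      swap = ℤ-Solver.solve-∀
      bound : ∀ i → 2 + i ≤ suc n → suc n ∸ (2 + i) < k + q * suc e
      bound i i≤ = +-cancelˡ-< (2 + i) _ _ (≤-<-trans (≤-reflexive (trans (m+[n∸m]≡n i≤) n≡′))
        (s≤s (s≤s (m≤n+m (k + q * suc e) i))))

    step : + (suc n !) ℤ.* + p ∣[ p ] π ℤ.^ suc e ℤ.* T (suc n) (suc k)
      ℤ.- (π ℤ.^ e ℤ.* T (suc n) (k + p) ℤ.+ + suc n ℤ.* (π ℤ.^ suc e ℤ.* T n k))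
    -- Newton's identity enters as an added zero, `P` times the difference of its two sides. Then
    -- `T (suc n) k` cancels, and -p times `P` is `π ℤ.^ suc e`.
    step = subst (+ (suc n !) ℤ.* + p ∣[ p ]_)
      (trans (trans (sym (ℤ.+-identityʳ _)) (cong (λ s → P ℤ.* E₁ ℤ.- P ℤ.* E₂ ℤ.+ s) (sym (trans
          (cong (λ s → P ℤ.* Y ℤ.- P ℤ.* s) (trans (sym lhs) (trans (newton p (suc n) k) rhs)))
          (ℤ.+-inverseʳ (P ℤ.* Y))))))
        (eliminate (+ p) P (T (suc n) k) (T (suc n) (suc k)) (T (suc n) (k + p)) (T n k) E₁ E₂ (+ suc n)))
      (∣ₚ-+ pr p*n!∣P*E₁ (∣ₚ-neg pr p*n!∣P*E₂))
      where
      Y : ℤ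
      Y = T (suc n) k ℤ.+ (+ suc n ℤ.* (+ p ℤ.* T n k) ℤ.+ E₂)
      eliminate : ∀ p P a a₁ aₚ b E₁ E₂ n →
        P ℤ.* E₁ ℤ.- P ℤ.* E₂ ℤ.+ (P ℤ.* (a ℤ.+ (n ℤ.* (p ℤ.* b) ℤ.+ E₂))
          ℤ.- P ℤ.* (a ℤ.+ (p ℤ.* a₁ ℤ.+ (E₁ ℤ.+ aₚ)))) ≡
        ℤ.- p ℤ.* P ℤ.* a₁ ℤ.- (P ℤ.* aₚ ℤ.+ n ℤ.* (ℤ.- p ℤ.* P ℤ.* b))
      eliminate = ℤ-Solver.solve-∀

  -- That is, (-p)^e T(n,k) / n! ≡ C(k + p e, e) mod p; n! need not be prime to p, so it is cleared.
  T-mod-p : ∀ e k n N → n ≡ k + q * e → N ≡ k + p * e →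
    + (n !) ℤ.* + p ∣[ p ] π ℤ.^ e ℤ.* T n k ℤ.- + (n !) ℤ.* + (N C e)
  T-mod-p zero k n N n≡ N≡ = subst (+ (n !) ℤ.* + p ∣[ p ]_) (sym vanish) (∣ₚ0 pr)
    where
    n≡k : n ≡ k
    n≡k = trans n≡ (trans (cong (λ m → k + m) (*-zeroʳ q)) (+-identityʳ k))
    vanish : 1ℤ ℤ.* T n k ℤ.- + (n !) ℤ.* 1ℤ ≡ 0ℤ
    vanish = begin
      1ℤ ℤ.* T n k ℤ.- + (n !) ℤ.* 1ℤ
        ≡⟨ cong₂ ℤ._-_ (ℤ.*-identityˡ (T n k)) (ℤ.*-identityʳ (+ (n !))) ⟩
      T n k ℤ.- + (n !)
        ≡⟨ cong (ℤ._- + (n !)) (subst (λ m → T n m ≡ + (n !)) n≡k (T-diagonal n)) ⟩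
      + (n !) ℤ.- + (n !)
        ≡⟨ ℤ.+-inverseʳ (+ (n !)) ⟩
      0ℤ ∎
  T-mod-p (suc e) zero n N refl refl = ∣ₚ-+ pr
    (subst (+ (n !) ℤ.* + p ∣[ p ]_) (sym (ℤ.*-zeroʳ (π ℤ.^ suc e))) (∣ₚ0 pr))
    (∣ₚ-neg pr (∣ₚ-* pr {+ (n !)} {+ p} {+ (n !)} {+ (N C suc e)} (∣ₚ-refl pr) (∣⇒∣ₚ (p∣[p*n]Cn e))))
  -- The recursion is lexicographic in (e, k): one call lowers e and raises k by p, the other lowers
  -- k. Both have upper index `N′`, because (k + p) + p e = k + p (e + 1), and N is `suc N′`, as
  -- Pascal's rule wants.
  T-mod-p (suc e) (suc k) n N refl refl = subst (M ∣[ p ]_) combine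
    (∣ₚ-+ pr (∣ₚ-+ pr (MainStep.step k n′ e n≡) (T-mod-p e (k + p) n N′ n≡ N′≡))
      (subst (_∣[ p ] + n ℤ.* (π ℤ.^ suc e ℤ.* T n′ k ℤ.- + (n′ !) ℤ.* + (N′ C suc e)))
        (trans (sym (ℤ.*-assoc (+ n) (+ (n′ !)) (+ p))) (cong (ℤ._* + p) (sym (ℤ.pos-* n (n′ !)))))
        (∣ₚ-* pr {+ n} {+ (n′ !) ℤ.* + p} {+ n} (∣ₚ-refl pr) (T-mod-p (suc e) k n′ N′ refl refl))))
    where
    n′ N′ : ℕ
    n′ = k + q * suc e
    N′ = k + p * suc e
    M : ℤ
    M = + (n !) ℤ.* + p
    n≡ : n ≡ k + p + q * e
    n≡ = regroup k r e
      where
      regroup : ∀ k r e → suc (k + suc r * suc e) ≡ k + suc (suc r) + suc r * e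
      regroup = ℕ-Solver.solve-∀
    N′≡ : N′ ≡ k + p + p * e
    N′≡ = trans (cong (λ m → k + m) (*-suc p e)) (sym (+-assoc k p (p * e)))
    A B b : ℤ
    A = π ℤ.^ suc e ℤ.* T n (suc k)
    B = π ℤ.^ e ℤ.* T n (k + p)
    b = π ℤ.^ suc e ℤ.* T n′ k
    combine : A ℤ.- (B ℤ.+ + n ℤ.* b) ℤ.+ (B ℤ.- + (n !) ℤ.* + (N′ C e))
                ℤ.+ + n ℤ.* (b ℤ.- + (n′ !) ℤ.* + (N′ C suc e)) ≡
              A ℤ.- + (n !) ℤ.* + (N C suc e)
    combine = begin
      A ℤ.- (B ℤ.+ + n ℤ.* b) ℤ.+ (B ℤ.- + (n !) ℤ.* + (N′ C e))
        ℤ.+ + n ℤ.* (b ℤ.- + (n′ !) ℤ.* + (N′ C suc e))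
        ≡⟨ cong (λ f → A ℤ.- (B ℤ.+ + n ℤ.* b) ℤ.+ (B ℤ.- f ℤ.* + (N′ C e))
             ℤ.+ + n ℤ.* (b ℤ.- + (n′ !) ℤ.* + (N′ C suc e))) (ℤ.pos-* n (n′ !)) ⟩
      A ℤ.- (B ℤ.+ + n ℤ.* b) ℤ.+ (B ℤ.- + n ℤ.* + (n′ !) ℤ.* + (N′ C e))
        ℤ.+ + n ℤ.* (b ℤ.- + (n′ !) ℤ.* + (N′ C suc e))
        ≡⟨ cancel A B b (+ n) (+ (n′ !)) (+ (N′ C e)) (+ (N′ C suc e)) ⟩
      A ℤ.- + n ℤ.* + (n′ !) ℤ.* (+ (N′ C e) ℤ.+ + (N′ C suc e))
        ≡⟨ cong₂ (λ f c → A ℤ.- f ℤ.* + c) (sym (ℤ.pos-* n (n′ !))) (nCk+nC[k+1]≡[n+1]C[k+1] N′ e) ⟩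
      A ℤ.- + (n !) ℤ.* + (N C suc e) ∎
      where
      cancel : ∀ A B b n f x y → A ℤ.- (B ℤ.+ n ℤ.* b) ℤ.+ (B ℤ.- n ℤ.* f ℤ.* x) ℤ.+ n ℤ.* (b ℤ.- f ℤ.* y) ≡
        A ℤ.- n ℤ.* f ℤ.* (x ℤ.+ y)
      cancel = ℤ-Solver.solve-∀

  -- Binomial coefficients prime to p.

  p*j∣p^h : ∀ h {j} → 0 < j → j < p ^ h → + p ℤ.* + j ∣[ p ] + (p ^ h)
  p*j∣p^h zero    {suc j} _ (s≤s ())
  p*j∣p^h (suc h) {j} 0<j j<p^h with p ∣? j
  ... | no p∤j = subst (_∣[ p ] + (p ^ suc h)) (ℤ.*-comm (+ j) (+ p))
    (∣ₚ-trans pr (∣ₚ-* pr {+ j} {+ p} (unit∣ₚ1 pr p∤j) (∣ₚ-refl pr))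
      (subst (_∣[ p ] + (p ^ suc h)) (sym (ℤ.*-identityˡ (+ p))) (∣⇒∣ₚ (m∣m*n (p ^ h)))))
  ... | yes (divides m refl) = subst₂ _∣[ p ]_
    (cong (λ x → + p ℤ.* x) (trans (sym (ℤ.pos-* p m)) (cong +_ (*-comm p m)))) (sym (ℤ.pos-* p (p ^ h)))
    (∣ₚ-* pr {+ p} {+ p ℤ.* + m} {+ p} (∣ₚ-refl pr) (p*j∣p^h h (0<m m 0<j)
      (*-cancelʳ-< p m (p ^ h) (<-≤-trans j<p^h (≤-reflexive (*-comm p (p ^ h)))))))
    where
    0<m : ∀ m → 0 < m * p → 0 < m
    0<m (suc m) _ = s≤s z≤n

  -- Put M = a p^h. For 0 < j < p^h the valuation of j is below h, so p divides M / j at p. Hence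
  -- C(M+j, j) = (1 + M/j) C(M+j-1, j-1) is congruent to C(M+j-1, j-1), and the chain ends at C(M,
  -- 0) = 1.
  p∤[ap^h+e]Ce : ∀ a h e → e < p ^ h → ¬ p ∣ (a * p ^ h + e) C e
  p∤[ap^h+e]Ce a h zero    _     = p∤1 pr
  p∤[ap^h+e]Ce a h (suc e) e<p^h p∣C′ = p∤[ap^h+e]Ce a h e (<-trans (n<1+n e) e<p^h)
    -- The congruence is established after multiplication by j, which is then cancelled.
    (p∣ₚ⇒p∣ pr (∣ₚ-cancelˡ pr (+ j) (subst (+ j ℤ.* + p ∣[ p ]_) difference (∣ₚ-+ pr pj∣jC′ (∣ₚ-neg pr pj∣MC)))))
    where
    j M c c′ : ℕ
    j  = suc e
    M  = a * p ^ h
    c  = (M + e) C e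
    c′ = (M + j) C j
    pj∣jC′ : + j ℤ.* + p ∣[ p ] + j ℤ.* + c′
    pj∣jC′ = ∣ₚ-* pr {+ j} {+ p} {+ j} {+ c′} (∣ₚ-refl pr) (∣⇒∣ₚ p∣C′)
    pj∣MC : + j ℤ.* + p ∣[ p ] + c ℤ.* (+ a ℤ.* + (p ^ h))
    pj∣MC = subst (_∣[ p ] + c ℤ.* (+ a ℤ.* + (p ^ h))) (ℤ.*-comm (+ p) (+ j))
      (∣ₚ-*ˡ pr (+ c) (∣ₚ-*ˡ pr (+ a) (p*j∣p^h h (s≤s z≤n) e<p^h)))
    absorb : j * c′ ≡ (M + j) * c
    absorb = trans (cong (λ m → j * (m C j)) (+-suc M e))
      (trans ([k+1]*[n+1]C[k+1]≡[n+1]*nCk (M + e) e) (cong (_* c) (sym (+-suc M e))))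
    difference : + j ℤ.* + c′ ℤ.+ ℤ.- (+ c ℤ.* (+ a ℤ.* + (p ^ h))) ≡ + j ℤ.* + c
    difference = begin
      + j ℤ.* + c′ ℤ.+ ℤ.- (+ c ℤ.* (+ a ℤ.* + (p ^ h)))
        ≡⟨ cong₂ (λ x y → x ℤ.+ ℤ.- (+ c ℤ.* y)) (trans (sym (ℤ.pos-* j c′)) (trans (cong +_ absorb) (ℤ.pos-* (M + j) c)))
             (sym (ℤ.pos-* a (p ^ h))) ⟩
      (+ M ℤ.+ + j) ℤ.* + c ℤ.+ ℤ.- (+ c ℤ.* + M)
        ≡⟨ cancel (+ M) (+ j) (+ c) ⟩
      + j ℤ.* + c ∎
      where
      cancel : ∀ M j c → (M ℤ.+ j) ℤ.* c ℤ.+ ℤ.- (c ℤ.* M) ≡ j ℤ.* c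
      cancel = ℤ-Solver.solve-∀

  -- The valuation of S(n,k).

  p^~π^ : ∀ m → + (p ^ m) ~[ p ] π ℤ.^ m
  p^~π^ zero    = ~-refl pr
  p^~π^ (suc m) = subst (_~[ p ] π ℤ.^ suc m) (sym (ℤ.pos-* p (p ^ m)))
    (~-* pr {+ p} {+ (p ^ m)} {π} p~π (p^~π^ m))

  S-valuation : ∀ a h k → 1 ≤ a → a < p → 1 ≤ k → k ≤ a * p ^ h → q ∣ a * p ^ h ∸ k →
    ∃[ v ] (IsValuation p (S (a * p ^ h) k) v × σ p (a * p ^ h) + q * v ≡ σ p k × σ p (a * p ^ h) ≡ a)
  S-valuation a h k 1≤a a<p 1≤k k≤n (divides e n∸k≡eq) with legendre (a * p ^ h) | legendre k
  ... | ν , n-weight , n!~ | κ , k-weight , k!~ = v , (p^v∣S , p^1+v∤S) , weight , σn≡a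
    where
    n v : ℕ
    n = a * p ^ h
    -- The value dictated by p^e k! S(n,k) ~ n!; `e+κ≤ν` shows that the subtraction does not
    -- truncate.
    v = ν ∸ (e + κ)

    σn≡a : σ p n ≡ a
    σn≡a = σ-*^ p 1<p a<p h

    n≡ : n ≡ k + q * e
    n≡ = trans (sym (m+[n∸m]≡n k≤n)) (cong (λ m → k + m) (trans n∸k≡eq (*-comm e q)))

    -- (p - 1) e = n - k < n = a p^h ≤ (p - 1) p^h, strict because k ≥ 1.
    e<p^h : e < p ^ h
    e<p^h = *-cancelˡ-< q e (p ^ h) (<-≤-trans (m<n+m (q * e) 1≤k)
      (≤-trans (≤-reflexive (sym n≡)) (*-monoˡ-≤ (p ^ h) (≤-pred a<p))))

    n+e≡ : n + e ≡ k + p * e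
    n+e≡ = trans (cong (_+ e) n≡) (trans (+-assoc k (q * e) e) (cong (λ m → k + m) (+-comm (q * e) e)))

    residue : + (n !) ℤ.* + p ∣[ p ] π ℤ.^ e ℤ.* T n k ℤ.- + (n !) ℤ.* + ((n + e) C e)
    residue = T-mod-p e k n (n + e) n≡ n+e≡

    -- One direction is the unit residue, the other the integrality bound.
    π^eT~n! : π ℤ.^ e ℤ.* T n k ~[ p ] + (n !)
    π^eT~n! = residue-unit⇒∣ₚ pr (p∤[ap^h+e]Ce a h e e<p^h) residue ,
      n!∣π^e*T k n e (≤-<-trans (≤-reflexive n≡) (+-monoʳ-< k (*-monoʳ-< q (n<1+n e))))

    p^[e+κ]S~p^ν : + (p ^ (e + κ) * S n k) ~[ p ] + (p ^ ν)
    p^[e+κ]S~p^ν = subst (_~[ p ] + (p ^ ν)) (sym (ℤ.pos-* (p ^ (e + κ)) (S n k)))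
      (~-trans pr (~-* pr {+ (p ^ (e + κ))} {+ S n k} {π ℤ.^ (e + κ)} (p^~π^ (e + κ)) (~-refl pr))
      (~-trans pr (subst (_~[ p ] π ℤ.^ e ℤ.* T n k) split
          (~-* pr {π ℤ.^ e} {π ℤ.^ κ ℤ.* + S n k} {π ℤ.^ e} (~-refl pr)
            (subst (π ℤ.^ κ ℤ.* + S n k ~[ p ]_) (sym (ℤ.pos-* (k !) (S n k)))
              (~-* pr {π ℤ.^ κ} {+ S n k} {+ (k !)} (~-sym pr k!~) (~-refl pr)))))
      (~-trans pr π^eT~n! (~-trans pr n!~ (~-sym pr (p^~π^ ν))))))
      where
      split : π ℤ.^ e ℤ.* (π ℤ.^ κ ℤ.* + S n k) ≡ π ℤ.^ (e + κ) ℤ.* + S n k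
      split = trans (sym (ℤ.*-assoc (π ℤ.^ e) (π ℤ.^ κ) (+ S n k))) (cong (ℤ._* + S n k) (sym (ℤ.^-distribˡ-+-* π e κ)))

    e+κ≤ν : e + κ ≤ ν
    e+κ≤ν = p^-cancel-≤ pr (e + κ) ν (∣ₚ-trans pr
      (∣ₚ-trans pr (multiple pr (+ S n k)) (∣ₚ-reflexive pr
        (trans (sym (ℤ.pos-* (S n k) (p ^ (e + κ)))) (cong +_ (*-comm (S n k) (p ^ (e + κ)))))))
      (proj₁ p^[e+κ]S~p^ν))

    S~p^v : + S n k ~[ p ] + (p ^ v)
    S~p^v = ∣ₚ-cancelˡ pr (+ (p ^ (e + κ))) (proj₁ scaled) , ∣ₚ-cancelˡ pr (+ (p ^ (e + κ))) (proj₂ scaled)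
      where
      instance _ = m^n≢0 p (e + κ)
      scaled : + (p ^ (e + κ)) ℤ.* + S n k ~[ p ] + (p ^ (e + κ)) ℤ.* + (p ^ v)
      scaled = subst₂ _~[ p ]_ (ℤ.pos-* (p ^ (e + κ)) (S n k))
        (trans (cong +_ (trans (cong (p ^_) (sym (m+[n∸m]≡n e+κ≤ν))) (^-distribˡ-+-* p (e + κ) v)))
          (ℤ.pos-* (p ^ (e + κ)) (p ^ v)))
        p^[e+κ]S~p^ν

    p^v∣S : p ^ v ∣ S n k
    p^v∣S = p^∣ₚ⇒p^∣ pr v (proj₂ S~p^v)

    p^1+v∤S : ¬ p ^ suc v ∣ S n k
    p^1+v∤S (divides t S≡) = <-irrefl refl (p^-cancel-≤ pr (suc v) v (∣ₚ-trans pr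
      (subst (+ (p ^ suc v) ∣[ p ]_) (trans (sym (ℤ.pos-* t (p ^ suc v))) (cong +_ (sym S≡))) (multiple pr (+ t)))
      (proj₁ S~p^v)))

    -- Legendre's formulas for n! and k! are combined through n = k + (p - 1) e; adding (p - 1)(e +
    -- κ) to both sides removes the subtraction in `v`.
    weight : σ p n + q * v ≡ σ p k
    weight = +-cancelˡ-≡ (q * (e + κ)) _ _ (begin
      q * (e + κ) + (σ p n + q * v) ≡⟨ regroup q (e + κ) v (σ p n) ⟩
      q * (e + κ + v) + σ p n       ≡⟨ cong (λ m → q * m + σ p n) (m+[n∸m]≡n e+κ≤ν) ⟩
      q * ν + σ p n                 ≡⟨ n-weight ⟩
      n                             ≡⟨ n≡ ⟩
      k + q * e                     ≡⟨ cong (_+ q * e) k-weight ⟨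
      q * κ + σ p k + q * e         ≡⟨ regroup′ q e κ (σ p k) ⟩
      q * (e + κ) + σ p k ∎)
      where
      regroup : ∀ q x v s → q * x + (s + q * v) ≡ q * (x + v) + s
      regroup = ℕ-Solver.solve-∀
      regroup′ : ∀ q e κ s → q * κ + s + q * e ≡ q * (e + κ) + s
      regroup′ = ℕ-Solver.solve-∀

theorem2p2 : (p : ℕ) → (pr : Prime p) → .{{_ : NonZero p}} →
    (a h k : ℕ) → 1 ≤ a → a ≤ p ∸ 1 →
    1 ≤ k → k ≤ a * p ^ h → (p ∸ 1) ∣ (a * p ^ h ∸ k) →
    ∃[ v ] (IsValuation p (S (a * p ^ h) k) v
    × σ p (a * p ^ h) + (p ∸ 1) * v ≡ σ p k
    × σ p (a * p ^ h) ≡ a)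
theorem2p2 zero          pr a h k 1≤a a≤p-1 = contradiction pr ¬prime[0]
theorem2p2 (suc zero)    pr a h k 1≤a a≤p-1 = contradiction pr ¬prime[1]
theorem2p2 (suc (suc r)) pr a h k 1≤a a≤p-1 = AtPrime.S-valuation r pr a h k 1≤a (s≤s a≤p-1)
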